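{- Let $A$ be a partial combinatory algebra, and suppose $J:\mathcal{P}(A)\to\mathcal{P}(A)$ is (a map representing) a local operator on $\mathsf{RT}(A)$ which is discrete and preserves unions. Then there is a partial function $f$ on $A$ such that $J$ is isomorphic to $J_f$, the least local operator forcing $f$ to be realizable.
   Context: A pca is a set $A$ with a partial binary application $(a,b)\mapsto ab$ (associating to the left) for which there exist $\mathsf{k},\mathsf{s}\in A$ such that for all $a,b,c\in A$: $\mathsf{k}ab=a$; $\mathsf{s}ab$ is defined; and whenever $ac(bc)$ is defined, $\mathsf{s}abc$ is defined and equal to it. $t{\downarrow}$ means "$t$ is defined". Every pca has pairing and unpairing elements $\pi,\pi_0,\pi_1$ with $\pi_0(\pi ab)=a$, $\pi_1(\pi ab)=b$. $\mathrm{Ass}(A)$ has as objects pairs $(X,E)$ with $X$ a set and $E(x)\subseteq A$ nonempty for each $x\in X$; a morphism $(X,E)\to(Y,F)$ is a function $g:X\to Y$ for which some $a\in A$ satisfies $ab{\downarrow}$ and $ab\in F(g(x))$ for all $x\in X$, $b\in E(x)$. The realizability topos $\mathsf{RT}(A)$ is the ex/reg completion of $\mathrm{Ass}(A)$. For $U,V\subseteq A$, $U\Rightarrow V=\{a\in A\mid\forall x\in U\ (ax{\downarrow}\text{ and }ax\in V)\}$. Every local operator (Lawvere–Tierney topology) on $\mathsf{RT}(A)$ is represented by a function $J:\mathcal{P}(A)\to\mathcal{P}(A)$ for which the sets $\bigcap_{U}U\Rightarrow J(U)$, $\bigcap_U JJ(U)\Rightarrow J(U)$ and $\bigcap_{U,V}(U\Rightarrow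 V)\Rightarrow(J(U)\Rightarrow J(V))$ are all nonempty; such a $J$ is itself called a local operator. $J\leq K$ iff $\bigcap_U J(U)\Rightarrow K(U)$ is nonempty; $J$ and $K$ are isomorphic if $J\leq K$ and $K\leq J$. $J$ is discrete if $J(\{a\})\cap J(\{b\})=\emptyset$ whenever $a\neq b$. $J$ preserves unions if $J(\bigcup_i U_i)=\bigcup_i J(U_i)$ for all families of subsets of $A$. For a partial function $f:A\to A$ with domain $B$, let $(B,\{\cdot\})$ be the assembly assigning $\{b\}$ to $b$, and $(B,E)$ the assembly with $E(b)=\{\pi b f(b)\}$. $J_f$, the least local operator forcing $f$ to be realizable, is the least local operator inverting (i.e. whose sheafification makes an isomorphism of) the mono $(B,E)\to(B,\{\cdot\})$ given by the identity on $B$. Equivalently, it is the least local operator $J$ with $M\leq J$, where $M(U)=\{\pi be\mid b\in B,\ ef(b){\downarrow},\ ef(b)\in U\}$. -}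

module Defs where

open import Data.Fin.Base using (Fin; zero; suc)
open import Data.Nat.Base using (ℕ; suc)
open import Data.Product.Base using (∃-syntax; _×_; _,_; proj₁; proj₂)
open import Data.Vec.Base using (Vec; []; _∷_; lookup)
open import Function.Base using (_on_; id)
open import Function.Bundles using (_⇔_; mk⇔; Func)
open import Function.Construct.Identity using (function)
open import Level using (Level) renaming (suc to lsuc)
open import Relation.Binary.Bundles using (Setoid)
open import Relation.Binary.Core using (Rel)
open import Relation.Binary.PropositionalEquality
  using (_≡_; _≢_; refl; subst)
import Relation.Binary.PropositionalEquality.Properties as ≡
import Relation.Binary.Construct.On as On
open import Relation.Unary
  using (Pred; _∈_; _⊆_; _≐_; _∩_; ｛_｝; Satisfiable; Empty; ⋃; ⋂)

-- A partial binary application, given by its graph: a · b ↦ c says that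
-- ab is defined and equal to c.

record PartialApplication (ℓ : Level) : Set (lsuc ℓ) where
  field
    Carrier    : Set ℓ
    _·_↦_      : Carrier → Carrier → Carrier → Set ℓ
    functional : ∀ {a b c d} → a · b ↦ c → a · b ↦ d → c ≡ d

  infixl 7 _∙_
  infix  4 _⇓_ _↓

  data Term : Set ℓ where
    ⌜_⌝ : Carrier → Term
    _∙_ : Term → Term → Term

  -- t ⇓ c : the term t is defined (hence so are all its subterms) and
  -- equal to c.
  _⇓_ : Term → Carrier → Set ℓ
  ⌜ a ⌝   ⇓ c = a ≡ c
  (t ∙ u) ⇓ c = ∃[ a ] ∃[ b ] (t ⇓ a × u ⇓ b × a · b ↦ c)

  _↓ : Term → Set ℓ
  t ↓ = ∃[ c ] t ⇓ c

record PCA (ℓ : Level) : Set (lsuc ℓ) where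
  field
    partialApplication : PartialApplication ℓ

  open PartialApplication partialApplication public

  field
    k s : Carrier
    k-⇓ : ∀ a b → ⌜ k ⌝ ∙ ⌜ a ⌝ ∙ ⌜ b ⌝ ⇓ a
    s-↓ : ∀ a b → ⌜ s ⌝ ∙ ⌜ a ⌝ ∙ ⌜ b ⌝ ↓
    s-⇓ : ∀ a b c {d} →
          ⌜ a ⌝ ∙ ⌜ c ⌝ ∙ (⌜ b ⌝ ∙ ⌜ c ⌝) ⇓ d →
          ⌜ s ⌝ ∙ ⌜ a ⌝ ∙ ⌜ b ⌝ ∙ ⌜ c ⌝ ⇓ d

record Pairing {ℓ : Level} (𝔸 : PCA ℓ) : Set ℓ where
  open PCA 𝔸
  field
    π π₀ π₁ : Carrier
    π₀-⇓ : ∀ a b → ⌜ π₀ ⌝ ∙ (⌜ π ⌝ ∙ ⌜ a ⌝ ∙ ⌜ b ⌝) ⇓ a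
    π₁-⇓ : ∀ a b → ⌜ π₁ ⌝ ∙ (⌜ π ⌝ ∙ ⌜ a ⌝ ∙ ⌜ b ⌝) ⇓ b

-- The domain is { b | ∃ c. graph b c }.

record PartialFunction {ℓ : Level} (A : Set ℓ) : Set (lsuc ℓ) where
  field
    graph      : Rel A ℓ
    functional : ∀ {b c d} → graph b c → graph b d → c ≡ d

module LocalOperators {ℓ : Level} (𝔸 : PCA ℓ) where
  open PCA 𝔸

  infixr 8 _⇒_
  infix  4 _≼_ _≅_

  Subset : Set (lsuc ℓ)
  Subset = Pred Carrier ℓ

  _⇒_ : Subset → Subset → Subset
  (U ⇒ V) a = ∀ {x} → x ∈ U → ∃[ y ] (a · x ↦ y × y ∈ V)

  -- Two predicates denote the same subset when they are related by _≐_, so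
  -- a map 𝒫(A) → 𝒫(A) is an operation on predicates respecting _≐_.
  record IsLocalOperator (J : Subset → Subset) : Set (lsuc ℓ) where
    field
      cong : ∀ {U V} → U ≐ V → J U ≐ J V
      unit : Satisfiable (⋂ Subset λ U → U ⇒ J U)
      mult : Satisfiable (⋂ Subset λ U → J (J U) ⇒ J U)
      mono : Satisfiable (⋂ (Subset × Subset) λ (U , V) → (U ⇒ V) ⇒ (J U ⇒ J V))

  _≼_ : (J K : Subset → Subset) → Set (lsuc ℓ)
  J ≼ K = Satisfiable (⋂ Subset λ U → J U ⇒ K U)

  _≅_ : (J K : Subset → Subset) → Set (lsuc ℓ)
  J ≅ K = (J ≼ K) × (K ≼ J)

  Discrete : (Subset → Subset) → Set ℓ
  Discrete J = ∀ {a b} → a ≢ b → Empty (J ｛ a ｝ ∩ J ｛ b ｝)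

  PreservesUnions : (Subset → Subset) → Set (lsuc ℓ)
  PreservesUnions J =
    (I : Set ℓ) (U : I → Subset) → J (⋃ I U) ≐ ⋃ I (λ i → J (U i))

module Forcing {ℓ : Level} (𝔸 : PCA ℓ) (P : Pairing 𝔸) where
  open PCA 𝔸
  open Pairing P
  open LocalOperators 𝔸

  M : PartialFunction Carrier → Subset → Subset
  M f U x = ∃[ b ] ∃[ c ] ∃[ e ] ∃[ d ]
    (graph b c × ⌜ π ⌝ ∙ ⌜ b ⌝ ∙ ⌜ e ⌝ ⇓ x × e · c ↦ d × d ∈ U)
    where open PartialFunction f

  -- K is (a representative of) J_f.  This determines K up to _≅_.  See
  -- dense⇔M≼ below for the description in terms of assemblies.
  record IsLeastForcing (f : PartialFunction Carrier) (K : Subset → Subset) :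
                        Set (lsuc ℓ) where
    field
      isLocalOperator : IsLocalOperator K
      forces          : M f ≼ K
      least           : ∀ {L} → IsLocalOperator L → M f ≼ L → K ≼ L

-- Underlying sets of assemblies are setoids, so that the domain of a partial
-- function, whose elements carry a membership proof, can be one of them.

module Assemblies {ℓ : Level} (𝔸 : PCA ℓ) where
  open PCA 𝔸
  open LocalOperators 𝔸

  record Assembly : Set (lsuc ℓ) where
    field
      setoid : Setoid ℓ ℓ
    open Setoid setoid public renaming (Carrier to ∣_∣)
    field
      E         : ∣_∣ → Subset
      E-resp    : ∀ {x y} → x ≈ y → E x ⊆ E y
      inhabited : ∀ x → Satisfiable (E x)

  open Assembly using (∣_∣; E)

  record Morphism (X Y : Assembly) : Set ℓ where
    field
      func    : Func (Assembly.setoid X) (Assembly.setoid Y)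
    open Func func public
    field
      tracked : Satisfiable (⋂ ∣ X ∣ λ x → E X x ⇒ E Y (to x))

  -- The subobject of Y given by a mono m is the predicate
  -- y ↦ ⋃ { E(x) | m(x) = y }.  Sheafification for J inverts m precisely when
  -- m is J-dense, i.e. when Y is contained in the J-closure of that subobject.
  Dense : (Subset → Subset) → ∀ {X Y} → Morphism X Y → Set ℓ
  Dense J {X} {Y} m = Satisfiable (⋂ ∣ Y ∣ λ y →
    E Y y ⇒ J (⋃ (∃[ x ] Assembly._≈_ Y (to x) y) λ (x , _) → E X x))
    where open Morphism m

module CombinatoryCompleteness {ℓ : Level} (𝔸 : PCA ℓ) where
  open PCA 𝔸

  infixl 7 _⊙_

  data Poly (n : ℕ) : Set ℓ where
    var : Fin n → Poly n
    con : Carrier → Poly n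
    _⊙_ : Poly n → Poly n → Poly n

  _⟦_⟧ : ∀ {n} → Poly n → Vec Carrier n → Term
  var i   ⟦ ρ ⟧ = ⌜ lookup ρ i ⌝
  con a   ⟦ ρ ⟧ = ⌜ a ⌝
  (t ⊙ u) ⟦ ρ ⟧ = t ⟦ ρ ⟧ ∙ u ⟦ ρ ⟧

  ƛ : ∀ {n} → Poly (suc n) → Poly n
  ƛ (var zero)    = con s ⊙ con k ⊙ con k
  ƛ (var (suc i)) = con k ⊙ var i
  ƛ (con a)       = con k ⊙ con a
  ƛ (t ⊙ u)       = con s ⊙ ƛ t ⊙ ƛ u

  k-↓ : ∀ a → ⌜ k ⌝ ∙ ⌜ a ⌝ ↓
  k-↓ a with k-⇓ a a
  ... | y , _ , ka⇓y , _ = y , ka⇓y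

  ƛ-↓ : ∀ {n} (t : Poly (suc n)) ρ → ƛ t ⟦ ρ ⟧ ↓
  ƛ-↓ (var zero)    ρ = s-↓ k k
  ƛ-↓ (var (suc i)) ρ = k-↓ (lookup ρ i)
  ƛ-↓ (con a)       ρ = k-↓ a
  ƛ-↓ (t ⊙ u)       ρ with ƛ-↓ t ρ | ƛ-↓ u ρ
  ... | p , t⇓p | q , u⇓q with s-↓ p q
  ... | y , x , _ , (_ , _ , refl , refl , sp) , refl , xq =
    y , x , q , (s , p , refl , t⇓p , sp) , u⇓q , xq

  ƛ-β : ∀ {n} (t : Poly (suc n)) ρ {x w} →
        t ⟦ x ∷ ρ ⟧ ⇓ w → ƛ t ⟦ ρ ⟧ ∙ ⌜ x ⌝ ⇓ w
  ƛ-β (var zero) ρ {x} refl with k-↓ x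
  ... | y , kx@(_ , _ , refl , refl , k·x) with k-⇓ x y
  ... | _ , _ , (_ , _ , refl , refl , k·x′) , refl , y′·y =
    s-⇓ k k x (y , y , kx , kx , subst (_· y ↦ x) (functional k·x′ k·x) y′·y)
  ƛ-β (var (suc i)) ρ {x} refl = k-⇓ (lookup ρ i) x
  ƛ-β (con a)       ρ {x} refl = k-⇓ a x
  ƛ-β (t ⊙ u)       ρ {x} (a , b , t⇓a , u⇓b , ab)
    with ƛ-β t ρ t⇓a | ƛ-β u ρ u⇓b
  ... | p , _ , t⇓p , refl , px | q , _ , u⇓q , refl , qx
    with s-⇓ p q x (a , b , (p , x , refl , refl , px) , (q , x , refl , refl , qx) , ab)
  ... | y , _ , (z , _ , (_ , _ , refl , refl , sp) , refl , zq) , refl , yx =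
    y , x , (z , q , (s , p , refl , t⇓p , sp) , u⇓q , zq) , refl , yx

  ⇓-det : ∀ t {a b} → t ⇓ a → t ⇓ b → a ≡ b
  ⇓-det ⌜ _ ⌝   refl refl = refl
  ⇓-det (t ∙ u) (_ , _ , ta , ub , ab) (_ , _ , ta′ , ub′ , ab′)
    with ⇓-det t ta ta′ | ⇓-det u ub ub′
  ... | refl | refl = functional ab ab′

  -- The value of λx.t, and application of it.
  ƛ-val : ∀ {n} (t : Poly (suc n)) ρ → Carrier
  ƛ-val t ρ = proj₁ (ƛ-↓ t ρ)

  ƛ-val-β : ∀ {n} (t : Poly (suc n)) ρ {x w} →
            t ⟦ x ∷ ρ ⟧ ⇓ w → ƛ-val t ρ · x ↦ w
  ƛ-val-β t ρ {x} t⇓w with ƛ-β t ρ t⇓w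
  ... | y , _ , y⇓ , refl , yx =
    subst (_· x ↦ _) (⇓-det (ƛ t ⟦ ρ ⟧) y⇓ (proj₂ (ƛ-↓ t ρ))) yx

  pairing : Pairing 𝔸
  pairing = record
    { π = ƛ-val pair₃ []
    ; π₀ = ƛ-val first []
    ; π₁ = ƛ-val second []
    ; π₀-⇓ = λ a b → _ , _ , refl , pair-⇓ a b ,
        ƛ-val-β first [] (_ , k , refl , refl , ƛ-val-β pair₁ (b ∷ a ∷ []) (k-⇓ a b))
    ; π₁-⇓ = λ a b → _ , _ , refl , pair-⇓ a b ,
        ƛ-val-β second [] (_ , k̄ , refl , refl , ƛ-val-β pair₁ (b ∷ a ∷ [])
          (ƛ-val snd₁ (a ∷ []) , b ,
           (k̄ , a , refl , refl , ƛ-val-β (ƛ snd₁) [] (proj₂ (ƛ-↓ snd₁ (a ∷ [])))) ,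
           refl , ƛ-val-β snd₁ (a ∷ []) refl))
    }
    where
    pair₁ : Poly 3
    pair₁ = var zero ⊙ var (suc (suc zero)) ⊙ var (suc zero)
    pair₂ = ƛ pair₁
    pair₃ = ƛ pair₂
    snd₁ : Poly 2
    snd₁ = var zero
    k̄ = ƛ-val (ƛ snd₁) []
    first second : Poly 1
    first  = var zero ⊙ con k
    second = var zero ⊙ con k̄
    pair-⇓ : ∀ a b → ⌜ ƛ-val pair₃ [] ⌝ ∙ ⌜ a ⌝ ∙ ⌜ b ⌝ ⇓ ƛ-val pair₁ (b ∷ a ∷ [])
    pair-⇓ a b =
      ƛ-val pair₂ (a ∷ []) , b ,
      (_ , a , refl , refl , ƛ-val-β pair₃ [] (proj₂ (ƛ-↓ pair₂ (a ∷ [])))) ,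
      refl , ƛ-val-β pair₂ (a ∷ []) (proj₂ (ƛ-↓ pair₁ (b ∷ a ∷ [])))

module ForcingAsDensity {ℓ : Level} (𝔸 : PCA ℓ) (P : Pairing 𝔸)
                        (f : PartialFunction (PCA.Carrier 𝔸)) where
  open PCA 𝔸 hiding (functional)
  open Pairing P
  open LocalOperators 𝔸
  open Assemblies 𝔸
  open Forcing 𝔸 P
  open PartialFunction f
  open CombinatoryCompleteness 𝔸

  B : Setoid ℓ ℓ
  B = record
    { Carrier       = ∃[ b ] ∃[ c ] graph b c
    ; _≈_           = _≡_ on proj₁
    ; isEquivalence = On.isEquivalence proj₁ ≡.isEquivalence
    }

  π-↓ : ∀ a b → ⌜ π ⌝ ∙ ⌜ a ⌝ ∙ ⌜ b ⌝ ↓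
  π-↓ a b with π₀-⇓ a b
  ... | _ , x , _ , x⇓ , _ = x , x⇓

  π₀-↦ : ∀ {a b x} → ⌜ π ⌝ ∙ ⌜ a ⌝ ∙ ⌜ b ⌝ ⇓ x → π₀ · x ↦ a
  π₀-↦ {a} {b} x⇓ with π₀-⇓ a b
  ... | _ , y , refl , y⇓ , p = subst (π₀ ·_↦ a) (⇓-det (_ ∙ _) y⇓ x⇓) p

  π₁-↦ : ∀ {a b x} → ⌜ π ⌝ ∙ ⌜ a ⌝ ∙ ⌜ b ⌝ ⇓ x → π₁ · x ↦ b
  π₁-↦ {a} {b} x⇓ with π₁-⇓ a b
  ... | _ , y , refl , y⇓ , p = subst (π₁ ·_↦ b) (⇓-det (_ ∙ _) y⇓ x⇓) p

  domain : Assembly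
  domain = record
    { setoid    = B
    ; E         = λ (b , _) → ｛ b ｝
    ; E-resp    = λ { refl → id }
    ; inhabited = λ (b , _) → b , refl
    }

  realizedDomain : Assembly
  realizedDomain = record
    { setoid    = B
    ; E         = λ (b , c , _) x → ⌜ π ⌝ ∙ ⌜ b ⌝ ∙ ⌜ c ⌝ ⇓ x
    ; E-resp    = λ { {b , c , bc} {_ , d , bd} refl {x} →
                      subst (λ c → ⌜ π ⌝ ∙ ⌜ b ⌝ ∙ ⌜ c ⌝ ⇓ x) (functional bc bd) }
    ; inhabited = λ (b , c , _) → π-↓ b c
    }

  inclusion : Morphism realizedDomain domain
  inclusion = record
    { func    = function B
    ; tracked = π₀ , λ { (b , c , bc) x⇓ → b , π₀-↦ x⇓ , refl }
    }

  dense⇔M≼ : ∀ {K} → IsLocalOperator K → Dense K inclusion ⇔ (M f ≼ K)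
  dense⇔M≼ {K} isLocal = mk⇔ to from
    where
    open IsLocalOperator isLocal

    to : Dense K inclusion → M f ≼ K
    to (r , dense) = ƛ-val body [] , λ U → realizes U
      where
      μ = proj₁ mono
      inner : Poly 2
      inner = con π₁ ⊙ var (suc zero) ⊙ (con π₁ ⊙ var zero)
      body : Poly 1
      body = con μ ⊙ ƛ inner ⊙ (con r ⊙ (con π₀ ⊙ var zero))
      realizes : ∀ U → ƛ-val body [] ∈ (M f U ⇒ K U)
      realizes U {x} (b , c , e , d , bc , x⇓ , ec , d∈U)
        with dense (b , c , bc) refl
      ... | y , rb , y∈K = z , ƛ-val-β body [] body⇓ , z∈K
        where
        g = ƛ-val inner (x ∷ [])
        V = ⋃ (∃[ b′ ] proj₁ b′ ≡ b) (λ ((b′ , c′ , _) , _) v → ⌜ π ⌝ ∙ ⌜ b′ ⌝ ∙ ⌜ c′ ⌝ ⇓ v)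
        g∈ : g ∈ (V ⇒ U)
        g∈ {v} (((_ , c′ , bc′) , refl) , v⇓) with functional bc′ bc
        ... | refl = d ,
          ƛ-val-β inner (x ∷ [])
            (e , c , (π₁ , x , refl , refl , π₁-↦ x⇓) ,
             (π₁ , v , refl , refl , π₁-↦ v⇓) , ec) ,
          d∈U
        step = proj₂ mono (V , U) g∈
        h = proj₁ step
        step′ = proj₂ (proj₂ step) y∈K
        z = proj₁ step′
        z∈K = proj₂ (proj₂ step′)
        body⇓ : body ⟦ x ∷ [] ⟧ ⇓ z
        body⇓ = h , y ,
          (μ , g , refl , proj₂ (ƛ-↓ inner (x ∷ [])) , proj₁ (proj₂ step)) ,
          (r , b , refl , (π₀ , x , refl , refl , π₀-↦ x⇓) , rb) ,
          proj₁ (proj₂ step′)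

    -- For b in the domain of f and e = πb, the element πbe lies in
    -- M({πbf(b)}).
    from : M f ≼ K → Dense K inclusion
    from (m , M≼K) = ƛ-val body [] , λ { (b , c , bc) refl → realizes b c bc }
      where
      body : Poly 1
      body = con m ⊙ (con π ⊙ var zero ⊙ (con π ⊙ var zero))
      realizes : ∀ b c (bc : graph b c) → ∃[ y ] (ƛ-val body [] · b ↦ y ×
        y ∈ K (⋃ (∃[ b′ ] proj₁ b′ ≡ b) (λ ((b′ , c′ , _) , _) v → ⌜ π ⌝ ∙ ⌜ b′ ⌝ ∙ ⌜ c′ ⌝ ⇓ v)))
      realizes b c bc with π-↓ b c
      ... | d , e , _ , (_ , _ , refl , refl , πb) , refl , ec with π-↓ b e
      ... | x , x⇓@(q , _ , q⇓ , refl , qe)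
        with M≼K (⋃ (∃[ b′ ] proj₁ b′ ≡ b) (λ ((b′ , c′ , _) , _) v → ⌜ π ⌝ ∙ ⌜ b′ ⌝ ∙ ⌜ c′ ⌝ ⇓ v))
                 (b , c , e , d , bc , x⇓ , ec ,
                  ((b , c , bc) , refl) , e , c , (π , b , refl , refl , πb) , refl , ec)
      ... | y , mx , y∈K =
        y , ƛ-val-β body [] (m , x , refl ,
              (q , e , q⇓ , (π , b , refl , refl , πb) , qe) , mx) , y∈K

{-# OPTIONS --safe #-}

-- Take f(b) = c iff b ∈ J{c}; discreteness makes f single-valued.  Since J
-- preserves unions, J(U) = ⋃ { J{c} | c ∈ U }, so b ∈ J(U) iff f(b) is defined
-- and lies in U.  Pairing b with the identity then gives J ≼ M f, while M f ≼ J
-- is monotonicity of J, so J itself is the least local operator above M f.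

module Submission where

open import Axiom.ExcludedMiddle using (ExcludedMiddle)
open import Data.Empty using (⊥-elim)
open import Data.Fin.Base using (zero)
open import Data.Product.Base using (∃-syntax; _×_; _,_; proj₁; proj₂)
open import Data.Vec.Base using ([]; _∷_)
open import Level using (Level)
open import Relation.Binary.PropositionalEquality using (_≡_; refl)
open import Relation.Nullary using (yes; no)
open import Relation.Unary using (_∈_; _⊆_; _≐_; ｛_｝; ⋃)
open import Defs

module _ {ℓ : Level} (𝔸 : PCA ℓ) where
  open PCA 𝔸
  open LocalOperators 𝔸
  open CombinatoryCompleteness 𝔸

  ≼-refl : ∀ {J} → J ≼ J
  ≼-refl = ƛ-val (var zero) [] , λ U x∈J → _ , ƛ-val-β (var zero) [] refl , x∈J

  ≼-trans : ∀ {J K L} → J ≼ K → K ≼ L → J ≼ L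
  ≼-trans (a , J≼K) (b , K≼L) = ƛ-val body [] , λ U x∈J →
    let y , ax , y∈K = J≼K U x∈J
        z , by , z∈L = K≼L U y∈K
    in z , ƛ-val-β body [] (b , y , refl , (a , _ , refl , refl , ax) , by) , z∈L
    where
    body : Poly 1
    body = con b ⊙ (con a ⊙ var zero)

  module _ {J : Subset → Subset} (isLocal : IsLocalOperator J) where
    open IsLocalOperator isLocal

    -- Every `U` is the union of its singletons; `cong` carries membership in `J U` over to that
    -- presentation, where union preservation applies.
    J⊆⋃J-singletons : PreservesUnions J → ∀ {U} → J U ⊆ ⋃ (∃[ c ] c ∈ U) λ (c , _) → J ｛ c ｝
    J⊆⋃J-singletons J-⋃ {U} x∈J =
      proj₁ (J-⋃ (∃[ c ] c ∈ U) λ (c , _) → ｛ c ｝) (proj₁ (cong U≐⋃) x∈J)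
      where
      U≐⋃ : U ≐ ⋃ (∃[ c ] c ∈ U) λ (c , _) → ｛ c ｝
      U≐⋃ = (λ x∈U → (_ , x∈U) , refl) , λ { ((_ , c∈U) , refl) → c∈U }

    singletonInverse : ExcludedMiddle ℓ → Discrete J → PartialFunction Carrier
    singletonInverse em discrete = record
      { graph      = λ b c → b ∈ J ｛ c ｝
      ; functional = single-valued
      }
      where
      single-valued : ∀ {b c d} → b ∈ J ｛ c ｝ → b ∈ J ｛ d ｝ → c ≡ d
      -- Discreteness only refutes `c ≢ d`; deciding `c ≡ d` turns this into an equality.
      single-valued {b} {c} {d} b∈Jc b∈Jd with em {c ≡ d}
      ... | yes c≡d = c≡d
      ... | no  c≢d = ⊥-elim (discrete c≢d b (b∈Jc , b∈Jd))

    module _ (P : Pairing 𝔸) (em : ExcludedMiddle ℓ) (discrete : Discrete J) where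
      open Pairing P
      open Forcing 𝔸 P

      private
        f = singletonInverse em discrete

      open ForcingAsDensity 𝔸 P f using (π-↓; π₀-↦; π₁-↦)

      M≼J : M f ≼ J
      M≼J = ƛ-val body [] , realizes
        where
        μ = proj₁ mono
        body : Poly 1
        body = con μ ⊙ (con π₁ ⊙ var zero) ⊙ (con π₀ ⊙ var zero)
        realizes : ∀ U → ƛ-val body [] ∈ (M f U ⇒ J U)
        realizes U {x} (b , c , e , d , b∈Jc , x⇓ , ec , d∈U) =
          -- Since `e` sends `c` to `d ∈ U`, it realizes `｛ c ｝ ⇒ U`. Hence `μ e` realizes
          -- `J ｛ c ｝ ⇒ J U` and can be applied to `b`.
          let h , μe , h∈  = proj₂ mono (｛ c ｝ , U) λ { refl → d , ec , d∈U }
              z , hb , z∈J = h∈ b∈Jc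
          in z ,
             ƛ-val-β body []
               (h , b , (μ , e , refl , (π₁ , x , refl , refl , π₁-↦ x⇓) , μe) ,
                (π₀ , x , refl , refl , π₀-↦ x⇓) , hb) ,
             z∈J

      J≼M : PreservesUnions J → J ≼ M f
      J≼M J-⋃ = ƛ-val body [] , λ U x∈J →
        let (c , c∈U) , x∈Jc = J⊆⋃J-singletons J-⋃ x∈J
            y , y⇓           = π-↓ _ i
        in y , ƛ-val-β body [] y⇓ ,
           -- The second component of the pair must send `f(x) = c` into `U`; the identity `i` does
           -- so because `c ∈ U`.
           _ , c , i , c , x∈Jc , y⇓ , ƛ-val-β (var zero) [] refl , c∈U
        where
        i = ƛ-val (var zero) []
        body : Poly 1
        body = con π ⊙ var zero ⊙ con i

proposition3p8 : ∀ {ℓ : Level} → ExcludedMiddle ℓ →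
    (𝔸 : PCA ℓ) (P : Pairing 𝔸) →
    let open LocalOperators 𝔸
        open Forcing 𝔸 P
    in
    (J : Subset → Subset) → IsLocalOperator J → Discrete J → PreservesUnions J →
    ∃[ f ] ∃[ J-f ] (IsLeastForcing f J-f × J ≅ J-f)
proposition3p8 em 𝔸 P J isLocal discrete J-⋃ =
  singletonInverse 𝔸 isLocal em discrete , J ,
  record
    { isLocalOperator = isLocal
    ; forces          = M≼J 𝔸 isLocal P em discrete
    -- The witness for `J-f` is `J` itself, and it lies below `L` through `J ≼ M f ≼ L`.
    ; least           = λ {L} _ M≼L →
        ≼-trans 𝔸 {K = Forcing.M 𝔸 P (singletonInverse 𝔸 isLocal em discrete)} {L = L}
          (J≼M 𝔸 isLocal P em discrete J-⋃) M≼L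
    } ,
  ≼-refl 𝔸 {J} , ≼-refl 𝔸 {J}
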